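{- Let $q$ be a prime power of characteristic $p>3$, and let $d\ge1$ satisfy $d\equiv8\pmod p$. Write $Q(x)=x_1^2+\cdots+x_d^2$ on $\mathbb F_q^d$, let $e_1,\ldots,e_d$ be the standard basis, and put $\mathbf 1=(1,\ldots,1)$. Then $$X_d=\left\{\tfrac12\mathbf 1+e_i+e_j:1\le i<j\le d\right\}\cup\left\{\tfrac14\mathbf 1+e_i:1\le i\le d\right\}\cup\left\{\tfrac34\mathbf 1-e_i:1\le i\le d\right\}\cup\{\mathbf 1\}$$ is a two-distance set with squared distances $2$ and $4$, and $$|X_d|=\binom{d+2}{2}.$$
   Context: A set $S\subseteq\mathbb F_q^d$ is a two-distance set if $Q(x-y)$, over distinct $x,y\in S$, takes exactly two values; these values are its squared distances. -}

module Defs where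

open import Algebra.Bundles using (CommutativeRing; Semiring)
open import Data.Bool.Base using (if_then_else_)
open import Data.Fin.Base using (Fin) renaming (_<_ to _<ᶠ_)
open import Data.Fin.Properties using (_≟_)
open import Data.Integer.Base using (+_; _-_)
open import Data.Integer.Divisibility using () renaming (_∣_ to _∣ᶻ_)
open import Data.Nat.Base using (ℕ)
open import Data.Product.Base using (∃; ∃₂; _×_; proj₁)
open import Data.Sum.Base using (_⊎_)
open import Data.Vec.Functional using (Vector; zipWith; map; replicate)
import Data.Vec.Functional.Relation.Binary.Equality.Setoid as VecEq
open import Function.Bundles using (Inverse)
open import Level using (Level; _⊔_) renaming (suc to lsuc)
open import Relation.Binary.Bundles using (Setoid)
import Relation.Binary.Construct.On as On
open import Relation.Binary.PropositionalEquality.Properties using (setoid)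
open import Relation.Nullary.Decidable.Core using (does)
open import Relation.Nullary.Negation.Core using (¬_)
open import Relation.Unary using (Pred; _∈_; _∪_; _≐_)

infix 4 _≡_[mod_]

_≡_[mod_] : ℕ → ℕ → ℕ → Set
a ≡ b [mod n ] = (+ n) ∣ᶻ ((+ a) - (+ b))

HasCardinality : ∀ {a ℓ} → Setoid a ℓ → ℕ → Set (a ⊔ ℓ)
HasCardinality S n = Inverse (setoid (Fin n)) S

-- The inverse is a total operation whose value at 0# is left unspecified.
record Field (c ℓ : Level) : Set (lsuc (c ⊔ ℓ)) where
  field
    commutativeRing : CommutativeRing c ℓ

  open CommutativeRing commutativeRing public

  infix 8 _⁻¹

  field
    0≉1      : ¬ (0# ≈ 1#)
    _⁻¹      : Carrier → Carrier
    inverseʳ : ∀ x → ¬ (x ≈ 0#) → x * x ⁻¹ ≈ 1#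

module Space {c ℓ} (F : Field c ℓ) where

  open Field F public using (Carrier; _≈_; 0#; 1#; _⁻¹)
  private module F = Field F
  open import Algebra.Definitions.RawSemiring (Semiring.rawSemiring F.semiring) using (sum)
    renaming (_×_ to _×ᴺ_)
  open VecEq F.setoid public using (_≋_; ≋-setoid)

  infixl 6 _⊕_ _⊖_
  infixl 7 _·_

  ι : ℕ → Carrier
  ι n = n ×ᴺ 1#

  _⊕_ _⊖_ : ∀ {d} → Vector Carrier d → Vector Carrier d → Vector Carrier d
  _⊕_ = zipWith F._+_
  _⊖_ = zipWith F._-_

  _·_ : ∀ {d} → Carrier → Vector Carrier d → Vector Carrier d
  a · x = map (a F.*_) x

  Q : ∀ {d} → Vector Carrier d → Carrier
  Q x = sum (λ i → x i F.* x i)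

  𝟏 : ∀ {d} → Vector Carrier d
  𝟏 = replicate _ 1#

  e : ∀ {d} → Fin d → Vector Carrier d
  e i j = if does (i ≟ j) then 1# else 0#

  subsetoid : ∀ {d} → Pred (Vector Carrier d) ℓ → Setoid (c ⊔ ℓ) ℓ
  subsetoid {d} S = On.setoid (≋-setoid d) (proj₁ {B = S})

  SquaredDistances : ∀ {d} → Pred (Vector Carrier d) ℓ → Pred Carrier (c ⊔ ℓ)
  SquaredDistances S r =
    ∃₂ λ x y → x ∈ S × y ∈ S × ¬ (x ≋ y) × Q (x ⊖ y) ≈ r

  -- ≐ makes both values occur; together with a ≉ b there are exactly two.
  IsTwoDistanceSet : ∀ {d} → Pred (Vector Carrier d) ℓ → Carrier → Carrier → Set (c ⊔ ℓ)
  IsTwoDistanceSet S a b =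
    ¬ (a ≈ b) × SquaredDistances S ≐ (λ r → r ≈ a ⊎ r ≈ b)

  ½ ¼ ¾ : Carrier
  ½ = ι 2 ⁻¹
  ¼ = ι 4 ⁻¹
  ¾ = ι 3 F.* ι 4 ⁻¹

  X : ∀ d → Pred (Vector Carrier d) ℓ
  X d = (λ x → ∃₂ λ (i j : Fin d) → i <ᶠ j × x ≋ ½ · 𝟏 ⊕ e i ⊕ e j)
      ∪ (λ x → ∃ λ (i : Fin d) → x ≋ ¼ · 𝟏 ⊕ e i)
      ∪ (λ x → ∃ λ (i : Fin d) → x ≋ ¾ · 𝟏 ⊖ e i)
      ∪ (λ x → x ≋ 𝟏)

{-# OPTIONS --safe #-}
module Submission where

-- Label the points of X_d by the pairs i < j, two copies of Fin d and one extra
-- label. Each point is ¼ times the image of an integer vector a 𝟏 + 4u with u one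
-- of e_i + e_j, e_i, −e_i, 0, so the squared distance of two labelled points is
-- (c²d + 8c(Σu − Σv) + 16(|u|² + |v|² − 2⟨u,v⟩)) / 16 with c the difference of the
-- coefficients of 𝟏. As d = 8 in the field, this depends only on the kinds of the
-- labels and on ⟨u,v⟩, and running through the kinds gives 2 or 4 whenever the
-- labels differ. Neither value is 0, so distinct labels give distinct points.
--
-- The characteristic is reached from the cardinality: Σx = Σ(x + 1) gives q·1 = 0,
-- hence p·1 = 0 since q is a power of p; so 2 ≠ 0 because p is odd.

open import Defs
open import Algebra.Bundles using (CommutativeRing)
import Algebra.Properties.CommutativeSemigroup as CommutativeSemigroupProperties
import Algebra.Properties.Ring as RingProperties
import Algebra.Properties.Semiring.Mult as SemiringMult
import Algebra.Properties.Semiring.Sum as SemiringSum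
open import Data.Bool.Base using (true; false; if_then_else_)
open import Data.Fin.Base using (Fin; zero; suc; fromℕ<) renaming (_<_ to _<ᶠ_)
open import Data.Fin.Permutation using (Permutation; permutation; cast-id; _⟨$⟩ʳ_)
open import Data.Fin.Properties using (_≟_; <-irrelevant; <⇒≢; <-asym; +↔⊎; 1↔⊤)
open import Data.Integer.Base as ℤ using (ℤ; 0ℤ; 1ℤ; +_; -[1+_])
import Data.Integer.Divisibility.Signed as Signed
import Data.Integer.Properties as ℤ
open import Data.Integer.Tactic.RingSolver using (solve-∀)
open import Data.Nat.Base as ℕ using (ℕ; zero; suc; s≤s; z≤n)
open import Data.Nat.Combinatorics using (_C_; nC1≡n; nCk+nC[k+1]≡[n+1]C[k+1])
open import Data.Nat.Divisibility using (m%n≡0⇒n∣m)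
open import Data.Nat.DivMod using (_%_; _/_; m≡m%n+[m/n]*n; m%n<n)
open import Data.Nat.Primality using (Prime; prime⇒irreducible)
import Data.Nat.Properties as ℕ
open import Data.Nat.Tactic.RingSolver using () renaming (solve-∀ to ℕ-solve-∀)
open import Data.Product.Base using (∃; ∃₂; _×_; _,_; proj₁; proj₂)
open import Data.Sum.Base as Sum using (_⊎_; inj₁; inj₂)
open import Data.Sum.Function.Propositional using (_⊎-↔_)
open import Data.Unit.Base using (⊤; tt)
open import Function.Base using (_∘_; id)
open import Function.Bundles using (Inverse; _↔_; mk↔ₛ′)
open import Function.Properties.Inverse using (↔-refl; ↔-trans)
import Relation.Binary.Reasoning.Setoid as ≈-Reasoning
open import Relation.Binary.PropositionalEquality as ≡
  using (_≡_; _≢_; refl; sym; trans; cong; cong₂; module ≡-Reasoning)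
open import Relation.Nullary.Decidable using (Dec; does; yes; no; toSum; map′; dec-true; dec-false)
open import Relation.Nullary.Negation.Core using (¬_; contradiction)
open import Relation.Unary using (_∈_)

private module ℤ-Sum = SemiringSum (CommutativeRing.semiring ℤ.+-*-commutativeRing)

-- Labels of the points and their number.

Pair : ℕ → Set
Pair d = ∃₂ λ (i j : Fin d) → i <ᶠ j

Label : ℕ → Set
Label d = Pair d ⊎ Fin d ⊎ Fin d ⊎ ⊤

pattern pair i j i<j = inj₁ (i , j , i<j)
pattern low i        = inj₂ (inj₁ i)
pattern high i       = inj₂ (inj₂ (inj₁ i))
pattern top          = inj₂ (inj₂ (inj₂ tt))

-- A pair i < j in `Fin (suc d)` either has i = `zero`, leaving the predecessor of j free in
-- `Fin d`, or is a shifted pair from `Fin d`. This is the bijective form of `suc-C-2`.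
pairs-suc : ∀ d → (Fin d ⊎ Pair d) ↔ Pair (suc d)
pairs-suc d = mk↔ₛ′ to from to∘from from∘to
  where
  to : Fin d ⊎ Pair d → Pair (suc d)
  to (inj₁ j)             = zero , suc j , s≤s z≤n
  to (inj₂ (i , j , i<j)) = suc i , suc j , s≤s i<j
  from : Pair (suc d) → Fin d ⊎ Pair d
  from (zero  , suc j , s≤s z≤n) = inj₁ j
  from (suc i , suc j , s≤s i<j) = inj₂ (i , j , i<j)
  to∘from : ∀ x → to (from x) ≡ x
  to∘from (zero  , suc j , s≤s z≤n) = refl
  to∘from (suc i , suc j , s≤s i<j) = refl
  from∘to : ∀ x → from (to x) ≡ x
  from∘to (inj₁ j)             = refl
  from∘to (inj₂ (i , j , i<j)) = refl

suc-C-2 : ∀ n → suc n C 2 ≡ n ℕ.+ n C 2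
suc-C-2 n = trans (sym (nCk+nC[k+1]≡[n+1]C[k+1] n 1)) (cong (ℕ._+ n C 2) (nC1≡n n))

count-pairs : ∀ d → Fin (d C 2) ↔ Pair d
count-pairs zero    = mk↔ₛ′ (λ ()) (λ ()) (λ ()) (λ ())
count-pairs (suc d) = ↔-trans (cast-id (suc-C-2 d))
  (↔-trans +↔⊎ (↔-trans (↔-refl ⊎-↔ count-pairs d) (pairs-suc d)))

count-labels : ∀ d → Fin ((d ℕ.+ 2) C 2) ↔ Label d
count-labels d = ↔-trans (cast-id size)
  (↔-trans +↔⊎ (count-pairs d ⊎-↔ ↔-trans +↔⊎ (↔-refl ⊎-↔ ↔-trans +↔⊎ (↔-refl ⊎-↔ 1↔⊤))))
  where
  open ≡-Reasoning
  rearrange : ∀ d t → suc d ℕ.+ (d ℕ.+ t) ≡ t ℕ.+ (d ℕ.+ (d ℕ.+ 1))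
  rearrange = ℕ-solve-∀
  -- Pascal's rule twice gives (d + 1) + d + C(d, 2), regrouped in the order of the summands of
  -- `Label`.
  size : (d ℕ.+ 2) C 2 ≡ d C 2 ℕ.+ (d ℕ.+ (d ℕ.+ 1))
  size = begin
    (d ℕ.+ 2) C 2                   ≡⟨ cong (_C 2) (ℕ.+-comm d 2) ⟩
    suc (suc d) C 2                 ≡⟨ suc-C-2 (suc d) ⟩
    suc d ℕ.+ suc d C 2             ≡⟨ cong (suc d ℕ.+_) (suc-C-2 d) ⟩
    suc d ℕ.+ (d ℕ.+ d C 2)         ≡⟨ rearrange d (d C 2) ⟩
    d C 2 ℕ.+ (d ℕ.+ (d ℕ.+ 1))     ∎

-- Squared distances computed over the integers.

module IntegerCoordinates where

  open import Data.Integer.Base using (_+_; _*_; -_; _-_)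
  open ℤ-Sum using (sum; sum-cong-≗; ∑-distrib-+; *-distribˡ-sum)

  δ : ∀ {d} → Fin d → Fin d → ℤ
  δ i j = if does (i ≟ j) then 1ℤ else 0ℤ

  δ-refl : ∀ {d} (i : Fin d) → δ i i ≡ 1ℤ
  δ-refl i = cong (if_then 1ℤ else 0ℤ) (dec-true (i ≟ i) refl)

  δ-≢ : ∀ {d} {i j : Fin d} → i ≢ j → δ i j ≡ 0ℤ
  δ-≢ {i = i} {j} i≢j = cong (if_then 1ℤ else 0ℤ) (dec-false (i ≟ j) i≢j)

  -- The point labelled l is ¼ (base l · 𝟏 + 4 · direction l), where direction l is
  -- the functional pairing l read as a vector.
  base : ∀ {d} → Label d → ℤ
  base (pair _ _ _) = + 2
  base (low _)      = + 1
  base (high _)     = + 3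
  base top          = + 4

  pairing : ∀ {d} → Label d → (Fin d → ℤ) → ℤ
  pairing (pair i j _) f = f i + f j
  pairing (low i)      f = f i
  pairing (high i)     f = - f i
  pairing top          f = 0ℤ

  direction : ∀ {d} → Label d → Fin d → ℤ
  direction l k = pairing l (λ i → δ i k)

  quadruple : ∀ {d} → Label d → Fin d → ℤ
  quadruple l k = base l + + 4 * direction l k

  sum-δ : ∀ {d} (i : Fin d) (f : Fin d → ℤ) → sum (λ k → δ i k * f k) ≡ f i
  sum-δ {suc d} zero f = begin
    1ℤ * f zero + sum (λ k → 0ℤ * f (suc k)) ≡⟨ cong (_+_ (1ℤ * f zero)) (*-distribˡ-sum 0ℤ (f ∘ suc)) ⟨
    1ℤ * f zero + 0ℤ * sum (f ∘ suc)         ≡⟨ unit (f zero) (sum (f ∘ suc)) ⟩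
    f zero                                   ∎
    where
    open ≡-Reasoning
    unit : ∀ a b → 1ℤ * a + 0ℤ * b ≡ a
    unit = solve-∀
  sum-δ {suc d} (suc i) f = trans (unit (f zero) _) (sum-δ i (f ∘ suc))
    where
    unit : ∀ a b → 0ℤ * a + b ≡ b
    unit = solve-∀

  -- Ties the functional to the vector it encodes: a sum over all d coordinates against a direction
  -- collapses to at most two evaluations. Linearity reduces the nonzero kinds to `sum-δ`.
  sum-direction : ∀ {d} (l : Label d) (f : Fin d → ℤ) → sum (λ k → direction l k * f k) ≡ pairing l f
  sum-direction (pair i j _) f = begin
    sum (λ k → (δ i k + δ j k) * f k)                       ≡⟨ sum-cong-≗ (λ k → ℤ.*-distribʳ-+ (f k) (δ i k) (δ j k)) ⟩
    sum (λ k → δ i k * f k + δ j k * f k)                   ≡⟨ ∑-distrib-+ (λ k → δ i k * f k) (λ k → δ j k * f k) ⟩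
    sum (λ k → δ i k * f k) + sum (λ k → δ j k * f k)       ≡⟨ cong₂ _+_ (sum-δ i f) (sum-δ j f) ⟩
    f i + f j                                               ∎
    where open ≡-Reasoning
  sum-direction (low i) f = sum-δ i f
  sum-direction (high i) f = begin
    sum (λ k → - δ i k * f k)            ≡⟨ sum-cong-≗ (λ k → out (δ i k) (f k)) ⟩
    sum (λ k → - 1ℤ * (δ i k * f k))     ≡⟨ *-distribˡ-sum (- 1ℤ) (λ k → δ i k * f k) ⟨
    - 1ℤ * sum (λ k → δ i k * f k)       ≡⟨ cong (- 1ℤ *_) (sum-δ i f) ⟩
    - 1ℤ * f i                           ≡⟨ ℤ.-1*i≡-i (f i) ⟩
    - f i                                ∎
    where
    open ≡-Reasoning
    out : ∀ a b → - a * b ≡ - 1ℤ * (a * b)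
    out = solve-∀
  sum-direction {d} top f = sym (*-distribˡ-sum 0ℤ f)

  sum-constant : ∀ d x → sum {d} (λ _ → x) ≡ x * + d
  sum-constant zero    x = sym (ℤ.*-zeroʳ x)
  sum-constant (suc d) x = trans (cong (_+_ x) (sum-constant d x)) (step x (+ d))
    where
    step : ∀ x y → x + x * y ≡ x * (1ℤ + y)
    step = solve-∀

  inner : ∀ {d} → Label d → Label d → ℤ
  inner l m = pairing l (direction m)

  -- The coordinate sum and the squared length of `direction`, recorded as constants because they
  -- depend only on the kind of the label.
  total norm : ∀ {d} → Label d → ℤ
  total (pair _ _ _) = + 2
  total (low _)      = + 1
  total (high _)     = - + 1
  total top          = + 0

  norm (pair _ _ _) = + 2
  norm (low _)      = + 1
  norm (high _)     = + 1
  norm top          = + 0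

  inner-sym : ∀ {d} (l m : Label d) → inner l m ≡ inner m l
  inner-sym l m = begin
    inner l m                                ≡⟨ sum-direction l (direction m) ⟨
    sum (λ k → direction l k * direction m k) ≡⟨ sum-cong-≗ (λ k → ℤ.*-comm (direction l k) (direction m k)) ⟩
    sum (λ k → direction m k * direction l k) ≡⟨ sum-direction m (direction l) ⟩
    inner m l                                ∎
    where open ≡-Reasoning

  -- For a pair the cross terms vanish, since i < j makes the two unit vectors distinct.
  inner-self : ∀ {d} (l : Label d) → inner l l ≡ norm l
  inner-self (pair i j i<j) =
    cong₂ _+_ (cong₂ _+_ (δ-refl i) (δ-≢ (<⇒≢ i<j ∘ sym))) (cong₂ _+_ (δ-≢ (<⇒≢ i<j)) (δ-refl j))
  inner-self (low i)  = δ-refl i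
  inner-self (high i) = cong (λ x → - - x) (δ-refl i)
  inner-self top      = refl

  -- Linearity, with the constant a contributing its multiple of the coordinate sum. The argument
  -- has the shape of `w` in `sum-squares`.
  pairing-affine : ∀ {d} (l : Label d) a f g →
    pairing l (λ k → a + + 2 * (f k - g k)) ≡ a * total l + + 2 * (pairing l f - pairing l g)
  pairing-affine (pair i j _) a f g = poly a (f i) (f j) (g i) (g j)
    where
    poly : ∀ a x y z w → (a + + 2 * (x - z)) + (a + + 2 * (y - w)) ≡ a * + 2 + + 2 * ((x + y) - (z + w))
    poly = solve-∀
  pairing-affine (low i) a f g = poly a (f i) (g i)
    where
    poly : ∀ a x y → a + + 2 * (x - y) ≡ a * + 1 + + 2 * (x - y)
    poly = solve-∀
  pairing-affine (high i) a f g = poly a (f i) (g i)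
    where
    poly : ∀ a x y → - (a + + 2 * (x - y)) ≡ a * - + 1 + + 2 * (- x - - y)
    poly = solve-∀
  pairing-affine top a f g = poly a
    where
    poly : ∀ a → 0ℤ ≡ a * 0ℤ + + 2 * (0ℤ - 0ℤ)
    poly = solve-∀

  -- Twice the squared distance of the labelled points, once d = 8 in the field.
  separation : ∀ {d} → Label d → Label d → ℤ
  separation l m = (base l - base m) * ((base l - base m) + (total l - total m))
    + + 2 * (norm l + norm m) - + 4 * inner l m

  -- Expanding the squares leaves c² d plus terms free of d. Splitting c² d as c² (d - 8) + 8 c²
  -- isolates what vanishes when d = 8 and gives the rest the common factor 8.
  sum-squares : ∀ {d} (l m : Label d) →
    sum (λ k → (quadruple l k - quadruple m k) * (quadruple l k - quadruple m k)) ≡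
    (base l - base m) * (base l - base m) * (+ d - + 8) + + 8 * separation l m
  sum-squares {d} l m = begin
    sum (λ k → (quadruple l k - quadruple m k) * (quadruple l k - quadruple m k))
      ≡⟨ sum-cong-≗ (λ k → expand (base l) (base m) (direction l k) (direction m k)) ⟩
    sum (λ k → c * c + (+ 8 * (direction l k * w k) + - + 8 * (direction m k * w k)))
      ≡⟨ ∑-distrib-+ (λ _ → c * c) (λ k → + 8 * (direction l k * w k) + - + 8 * (direction m k * w k)) ⟩
    sum {d} (λ _ → c * c) + sum (λ k → + 8 * (direction l k * w k) + - + 8 * (direction m k * w k))
      ≡⟨ cong₂ _+_ (sum-constant d (c * c))
           (∑-distrib-+ (λ k → + 8 * (direction l k * w k)) (λ k → - + 8 * (direction m k * w k))) ⟩
    c * c * + d + (sum (λ k → + 8 * (direction l k * w k)) + sum (λ k → - + 8 * (direction m k * w k)))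
      ≡⟨ cong (_+_ (c * c * + d)) (cong₂ _+_ (scale (+ 8) l) (scale (- + 8) m)) ⟩
    c * c * + d + (+ 8 * pairing l w + - + 8 * pairing m w)
      ≡⟨ cong (_+_ (c * c * + d)) (cong₂ (λ x y → + 8 * x + - + 8 * y) onˡ onᵐ) ⟩
    c * c * + d + (+ 8 * (c * total l + + 2 * (norm l - inner l m)) + - + 8 * (c * total m + + 2 * (inner l m - norm m)))
      ≡⟨ collect c (+ d) (total l) (total m) (norm l) (norm m) (inner l m) ⟩
    c * c * (+ d - + 8) + + 8 * separation l m ∎
    where
    open ≡-Reasoning
    c = base l - base m
    -- With t = u - v one has (c + 4t)² = c² + 8t(c + 2t); this is the factor c + 2t, which is then
    -- paired with u and with v.
    w = λ k → c + + 2 * (direction l k - direction m k)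
    scale : ∀ a n → sum (λ k → a * (direction n k * w k)) ≡ a * pairing n w
    scale a n = trans (sym (*-distribˡ-sum a (λ k → direction n k * w k))) (cong (a *_) (sum-direction n w))
    onˡ : pairing l w ≡ c * total l + + 2 * (norm l - inner l m)
    onˡ = trans (pairing-affine l c (direction l) (direction m))
      (cong (λ x → c * total l + + 2 * (x - inner l m)) (inner-self l))
    onᵐ : pairing m w ≡ c * total m + + 2 * (inner l m - norm m)
    onᵐ = trans (pairing-affine m c (direction l) (direction m))
      (cong₂ (λ x y → c * total m + + 2 * (x - y)) (inner-sym m l) (inner-self m))
    expand : ∀ a b u v →
      ((a + + 4 * u) - (b + + 4 * v)) * ((a + + 4 * u) - (b + + 4 * v)) ≡
      (a - b) * (a - b) + (+ 8 * (u * ((a - b) + + 2 * (u - v))) + - + 8 * (v * ((a - b) + + 2 * (u - v))))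
    expand = solve-∀
    collect : ∀ c d s t p q x →
      c * c * d + (+ 8 * (c * s + + 2 * (p - x)) + - + 8 * (c * t + + 2 * (x - q))) ≡
      c * c * (d - + 8) + + 8 * (c * (c + (s - t)) + + 2 * (p + q) - + 4 * x)
    collect = solve-∀

  separation-sym : ∀ {d} (l m : Label d) → separation l m ≡ separation m l
  separation-sym l m = trans
    (swap (base l) (base m) (total l) (total m) (norm l) (norm m) (inner l m))
    (cong (λ x → (base m - base l) * ((base m - base l) + (total m - total l))
      + + 2 * (norm m + norm l) - + 4 * x) (inner-sym l m))
    where
    swap : ∀ a b s t p q x →
      (a - b) * ((a - b) + (s - t)) + + 2 * (p + q) - + 4 * x ≡
      (b - a) * ((b - a) + (t - s)) + + 2 * (q + p) - + 4 * x
    swap = solve-∀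

  -- Case analysis over the kinds of two labels.

  EqualOrSeparated : ∀ {d} → Label d → Label d → Set
  EqualOrSeparated l m = l ≡ m ⊎ separation l m ≡ + 4 ⊎ separation l m ≡ + 8

  -- Once the kinds are known, the inner product is the only term that does not compute;
  -- substituting a numeral for it makes the right-hand side a closed integer.
  separation-at : ∀ {d} (l m : Label d) {x} → inner l m ≡ x →
    separation l m ≡ (base l - base m) * ((base l - base m) + (total l - total m)) + + 2 * (norm l + norm m) - + 4 * x
  separation-at l m = cong (λ x → (base l - base m) * ((base l - base m) + (total l - total m))
    + + 2 * (norm l + norm m) - + 4 * x)

  inner-pairs : ∀ {d} {i j k l : Fin d} (i<j : i <ᶠ j) (k<l : k <ᶠ l) {a b c e} →
    δ k i ≡ a → δ l i ≡ b → δ k j ≡ c → δ l j ≡ e →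
    inner (pair i j i<j) (pair k l k<l) ≡ (a + b) + (c + e)
  inner-pairs _ _ refl refl refl refl = refl

  -- toSum keeps with from abstracting the tests inside δ.
  compare-pairs : ∀ {d} {i j k l : Fin d} (i<j : i <ᶠ j) (k<l : k <ᶠ l) →
    EqualOrSeparated (pair i j i<j) (pair k l k<l)
  compare-pairs {i = i} {j} {k} {l} i<j k<l with toSum (k ≟ i) | toSum (l ≟ i) | toSum (k ≟ j) | toSum (l ≟ j)
  ... | inj₁ refl | _ | _ | inj₁ refl = inj₁ (cong (λ i<j → pair i j i<j) (<-irrelevant i<j k<l))
  -- Two pairs have separation 8 - 4x with x the number of shared indices: 4 for one shared index, 8
  -- for none.
  ... | inj₁ refl | _ | _ | inj₂ l≢j = inj₂ (inj₁ (separation-at (pair i j i<j) (pair k l k<l)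
    (inner-pairs i<j k<l (δ-refl i) (δ-≢ (<⇒≢ k<l ∘ sym)) (δ-≢ (<⇒≢ i<j)) (δ-≢ l≢j))))
  -- Here l = i and k = j, so k < l reads j < i, against i < j.
  ... | inj₂ _ | inj₁ refl | inj₁ refl | _ = contradiction k<l (<-asym i<j)
  ... | inj₂ k≢i | inj₁ refl | inj₂ k≢j | _ = inj₂ (inj₁ (separation-at (pair i j i<j) (pair k l k<l)
    (inner-pairs i<j k<l (δ-≢ k≢i) (δ-refl l) (δ-≢ k≢j) (δ-≢ (<⇒≢ i<j)))))
  ... | inj₂ k≢i | inj₂ l≢i | inj₁ refl | _ = inj₂ (inj₁ (separation-at (pair i j i<j) (pair k l k<l)
    (inner-pairs i<j k<l (δ-≢ k≢i) (δ-≢ l≢i) (δ-refl k) (δ-≢ (<⇒≢ k<l ∘ sym)))))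
  ... | inj₂ k≢i | inj₂ l≢i | inj₂ k≢j | inj₁ refl = inj₂ (inj₁ (separation-at (pair i j i<j) (pair k l k<l)
    (inner-pairs i<j k<l (δ-≢ k≢i) (δ-≢ l≢i) (δ-≢ k≢j) (δ-refl l))))
  ... | inj₂ k≢i | inj₂ l≢i | inj₂ k≢j | inj₂ l≢j = inj₂ (inj₂ (separation-at (pair i j i<j) (pair k l k<l)
    (inner-pairs i<j k<l (δ-≢ k≢i) (δ-≢ l≢i) (δ-≢ k≢j) (δ-≢ l≢j))))

  -- As i and j are distinct, k meets at most one of them. The sum is the inner product of e_i + e_j
  -- with e_k.
  δ-pair : ∀ {d} {i j : Fin d} → i <ᶠ j → ∀ k → δ k i + δ k j ≡ 1ℤ ⊎ δ k i + δ k j ≡ 0ℤ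
  δ-pair {i = i} {j} i<j k with k ≟ i | k ≟ j
  ... | yes refl | yes refl = contradiction refl (<⇒≢ i<j)
  ... | yes refl | no k≢j   = inj₁ refl
  ... | no k≢i   | yes refl = inj₁ refl
  ... | no k≢i   | no k≢j   = inj₂ refl

  -- Symmetry of `separation` halves the comparisons between different kinds.
  compare-sym : ∀ {d} (l m : Label d) → EqualOrSeparated m l → EqualOrSeparated l m
  compare-sym l m = Sum.map sym (Sum.map (trans (separation-sym l m)) (trans (separation-sym l m)))

  compare : ∀ {d} (l m : Label d) → EqualOrSeparated l m
  compare (pair _ _ i<j) (pair _ _ k<l) = compare-pairs i<j k<l
  compare l@(pair _ _ i<j) m@(low k) = inj₂ (Sum.map (separation-at l m) (separation-at l m) (δ-pair i<j k))
  -- The direction of `high k` is -e_k, so the separation is 4 + 4x with x as in `δ-pair`: meeting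
  -- gives 8 and missing gives 4, hence the swap.
  compare l@(pair i j i<j) m@(high k) = inj₂ (Sum.swap (Sum.map at at (δ-pair i<j k)))
    where
    at : ∀ {x} → δ k i + δ k j ≡ x → separation l m ≡ + 4 - + 4 * - x
    at eq = separation-at l m (trans (sym (ℤ.neg-distrib-+ (δ k i) (δ k j))) (cong -_ eq))
  compare (pair _ _ _) top = inj₂ (inj₁ refl)
  compare (low i) (low j) with toSum (j ≟ i)
  ... | inj₁ refl = inj₁ refl
  ... | inj₂ j≢i   = inj₂ (inj₁ (separation-at (low i) (low j) (δ-≢ j≢i)))
  compare (low i) (high j) with toSum (j ≟ i)
  ... | inj₁ refl = inj₂ (inj₂ (separation-at (low i) (high i) (cong -_ (δ-refl i))))
  ... | inj₂ j≢i   = inj₂ (inj₁ (separation-at (low i) (high j) (cong -_ (δ-≢ j≢i))))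
  compare (low _) top = inj₂ (inj₂ refl)
  compare (high i) (high j) with toSum (j ≟ i)
  ... | inj₁ refl = inj₁ refl
  ... | inj₂ j≢i   = inj₂ (inj₁ (separation-at (high i) (high j) (cong (λ x → - - x) (δ-≢ j≢i))))
  compare (high _) top = inj₂ (inj₁ refl)
  compare top top = inj₁ refl
  compare l@(low _)  m@(pair _ _ _) = compare-sym l m (compare m l)
  compare l@(high _) m@(pair _ _ _) = compare-sym l m (compare m l)
  compare l@(high _) m@(low _)      = compare-sym l m (compare m l)
  compare l@top      m@(pair _ _ _) = compare-sym l m (compare m l)
  compare l@top      m@(low _)      = compare-sym l m (compare m l)
  compare l@top      m@(high _)     = compare-sym l m (compare m l)

-- The image of the integers in a field.

module FieldProperties {c ℓ} (F : Field c ℓ) where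

  open import Data.Integer.Base using (_+_; _*_; -_; _-_; _⊖_)
  open Space F using (Carrier; _≈_; 0#; 1#; _⁻¹; ι)
  private module F = Field F
  open RingProperties F.ring using (-0#≈0#; -‿involutive; -‿distribˡ-*; -‿distribʳ-*; -‿+-comm; +-cancelˡ)
  open SemiringMult F.semiring using (×-homo-+; ×1-homo-*)
  open CommutativeSemigroupProperties F.+-commutativeSemigroup using () renaming (interchange to +-interchange)
  private module F-Sum = SemiringSum F.semiring
  open ≈-Reasoning F.setoid

  ι-+ : ∀ m n → ι (m ℕ.+ n) ≈ ι m F.+ ι n
  ι-+ = ×-homo-+ 1#

  ι-* : ∀ m n → ι (m ℕ.* n) ≈ ι m F.* ι n
  ι-* = ×1-homo-*

  ι-1 : ι 1 ≈ 1#
  ι-1 = F.+-identityʳ 1#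

  -- The canonical ring homomorphism from ℤ, through which the integer identities are carried into
  -- the field.
  η : ℤ → Carrier
  η (+ n)      = ι n
  η (-[1+ n ]) = F.- ι (suc n)

  η-neg : ∀ i → η (- i) ≈ F.- η i
  η-neg (+ zero)   = F.sym -0#≈0#
  η-neg (+ suc n)  = F.refl
  η-neg (-[1+ n ]) = F.sym (-‿involutive _)

  η-⊖ : ∀ m n → η (m ⊖ n) ≈ ι m F.- ι n
  η-⊖ m       zero    = F.sym (F.trans (F.+-congˡ -0#≈0#) (F.+-identityʳ (ι m)))
  η-⊖ zero    (suc n) = F.sym (F.+-identityˡ _)
  η-⊖ (suc m) (suc n) = begin
    η (suc m ⊖ suc n)                        ≡⟨ cong η (ℤ.[1+m]⊖[1+n]≡m⊖n m n) ⟩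
    η (m ⊖ n)                                ≈⟨ η-⊖ m n ⟩
    ι m F.- ι n                              ≈⟨ F.+-identityˡ _ ⟨
    0# F.+ (ι m F.- ι n)                     ≈⟨ F.+-congʳ (F.-‿inverseʳ 1#) ⟨
    (1# F.- 1#) F.+ (ι m F.- ι n)            ≈⟨ +-interchange 1# (F.- 1#) (ι m) (F.- ι n) ⟩
    (1# F.+ ι m) F.+ (F.- 1# F.+ F.- ι n)    ≈⟨ F.+-congˡ (-‿+-comm 1# (ι n)) ⟩
    ι (suc m) F.- ι (suc n)                  ∎

  η-+ : ∀ i j → η (i + j) ≈ η i F.+ η j
  η-+ (+ m)      (+ n)      = ι-+ m n
  η-+ (+ m)      (-[1+ n ]) = η-⊖ m (suc n)
  η-+ (-[1+ m ]) (+ n)      = F.trans (η-⊖ n (suc m)) (F.+-comm _ _)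
  η-+ (-[1+ m ]) (-[1+ n ]) = begin
    F.- ι (suc (suc (m ℕ.+ n)))        ≡⟨ cong (λ k → F.- ι (suc k)) (≡.sym (ℕ.+-suc m n)) ⟩
    F.- ι (suc m ℕ.+ suc n)            ≈⟨ F.-‿cong (ι-+ (suc m) (suc n)) ⟩
    F.- (ι (suc m) F.+ ι (suc n))      ≈⟨ -‿+-comm _ _ ⟨
    F.- ι (suc m) F.+ F.- ι (suc n)    ∎

  η-- : ∀ i j → η (i - j) ≈ η i F.- η j
  η-- i j = F.trans (η-+ i (- j)) (F.+-congˡ (η-neg j))

  η-*-pos : ∀ m j → η (+ m * j) ≈ ι m F.* η j
  η-*-pos m (+ n)      = F.trans (F.reflexive (cong η (≡.sym (ℤ.pos-* m n)))) (ι-* m n)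
  η-*-pos m (-[1+ n ]) = begin
    η (+ m * - + suc n)           ≡⟨ cong η (ℤ.neg-distribʳ-* (+ m) (+ suc n)) ⟨
    η (- (+ m * + suc n))         ≈⟨ η-neg (+ m * + suc n) ⟩
    F.- η (+ m * + suc n)         ≈⟨ F.-‿cong (η-*-pos m (+ suc n)) ⟩
    F.- (ι m F.* ι (suc n))       ≈⟨ -‿distribʳ-* _ _ ⟩
    ι m F.* F.- ι (suc n)         ∎

  η-* : ∀ i j → η (i * j) ≈ η i F.* η j
  η-* (+ m)      j = η-*-pos m j
  η-* (-[1+ m ]) j = begin
    η (- + suc m * j)             ≡⟨ cong η (ℤ.neg-distribˡ-* (+ suc m) j) ⟨
    η (- (+ suc m * j))           ≈⟨ η-neg (+ suc m * j) ⟩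
    F.- η (+ suc m * j)           ≈⟨ F.-‿cong (η-*-pos (suc m) j) ⟩
    F.- (ι (suc m) F.* η j)       ≈⟨ -‿distribˡ-* _ _ ⟩
    F.- ι (suc m) F.* η j         ∎

  η-sum : ∀ {n} (f : Fin n → ℤ) → F-Sum.sum (η ∘ f) ≈ η (ℤ-Sum.sum f)
  η-sum {zero}  f = F.refl
  η-sum {suc n} f = F.trans (F.+-congˡ (η-sum (f ∘ suc))) (F.sym (η-+ (f zero) (ℤ-Sum.sum (f ∘ suc))))

  -- Zero divisors and the characteristic of a finite field.

  *-≈0 : ∀ {x y} → ¬ (x ≈ 0#) → x F.* y ≈ 0# → y ≈ 0#
  *-≈0 {x} {y} x≉0 xy≈0 = begin
    y                         ≈⟨ F.*-identityˡ y ⟨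
    1# F.* y                  ≈⟨ F.*-congʳ (F.inverseʳ x x≉0) ⟨
    (x F.* x ⁻¹) F.* y        ≈⟨ F.*-congʳ (F.*-comm x (x ⁻¹)) ⟩
    (x ⁻¹ F.* x) F.* y        ≈⟨ F.*-assoc _ _ _ ⟩
    x ⁻¹ F.* (x F.* y)        ≈⟨ F.*-congˡ xy≈0 ⟩
    x ⁻¹ F.* 0#               ≈⟨ F.zeroʳ _ ⟩
    0#                        ∎

  -- Translation by 1 permutes the field, so it preserves the sum of all elements.
  ι-cardinality : ∀ {q} → HasCardinality F.setoid q → ι q ≈ 0#
  ι-cardinality {q} card = +-cancelˡ (F-Sum.sum to) _ _ (begin
    F-Sum.sum to F.+ ι q                       ≈⟨ F.+-congˡ (F-Sum.sum-replicate q) ⟨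
    F-Sum.sum to F.+ F-Sum.sum {q} (λ _ → 1#)  ≈⟨ F-Sum.∑-distrib-+ to (λ _ → 1#) ⟨
    F-Sum.sum (λ i → to i F.+ 1#)              ≈⟨ F-Sum.sum-cong-≋ (λ i → strictlyInverseˡ (to i F.+ 1#)) ⟨
    F-Sum.sum (λ i → to (π ⟨$⟩ʳ i))            ≈⟨ F-Sum.sum-permute to π ⟨
    F-Sum.sum to                               ≈⟨ F.+-identityʳ _ ⟨
    F-Sum.sum to F.+ 0#                        ∎)
    where
    open Inverse card
    translate : Carrier → Fin q → Fin q
    translate a i = from (to i F.+ a)
    cancel : ∀ a b → a F.+ b ≈ 0# → ∀ i → translate b (translate a i) ≡ i
    cancel a b a+b≈0 i = ≡.trans (from-cong (begin
      to (from (to i F.+ a)) F.+ b  ≈⟨ F.+-congʳ (strictlyInverseˡ _) ⟩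
      to i F.+ a F.+ b              ≈⟨ F.+-assoc _ _ _ ⟩
      to i F.+ (a F.+ b)            ≈⟨ F.+-congˡ a+b≈0 ⟩
      to i F.+ 0#                   ≈⟨ F.+-identityʳ _ ⟩
      to i                          ∎)) (strictlyInverseʳ i)
    π : Permutation q q
    π = permutation (translate 1#) (translate (F.- 1#))
      (cancel (F.- 1#) 1# (F.-‿inverseˡ 1#)) (cancel 1# (F.- 1#) (F.-‿inverseʳ 1#))

  -- Equality is tested on indices in `Fin q`. It supplies the decision on p = 0 with which `ι-^-≈0`
  -- starts.
  decidable : ∀ {q} → HasCardinality F.setoid q → ∀ x y → Dec (x ≈ y)
  decidable card x y = map′ injective from-cong (from x ≟ from y)
    where
    open Inverse card
    injective : from x ≡ from y → x ≈ y
    injective eq = F.trans (F.sym (strictlyInverseˡ x)) (F.trans (F.reflexive (cong to eq)) (strictlyInverseˡ y))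

  -- If p were nonzero in the field, its factors could be cancelled from p^k = 0 one at a time,
  -- ending in 1 = 0.
  ι-^-≈0 : ∀ {p} → Dec (ι p ≈ 0#) → ∀ k → ι (p ℕ.^ k) ≈ 0# → ι p ≈ 0#
  ι-^-≈0     (yes p≈0) k       _    = p≈0
  ι-^-≈0     (no _)    zero    1≈0  = contradiction (F.trans (F.sym 1≈0) ι-1) F.0≉1
  ι-^-≈0 {p} (no p≉0)  (suc k) pk≈0 = ι-^-≈0 (no p≉0) k (*-≈0 p≉0 (F.trans (F.sym (ι-* p (p ℕ.^ k))) pk≈0))

  -- An even prime would be 2, against 3 < p. For odd p, writing p = 1 + 2 (p / 2) with p = 2 = 0 in
  -- the field gives 1 = 0.
  ι-2≉0 : ∀ {p} → Prime p → 3 ℕ.< p → ι p ≈ 0# → ¬ (ι 2 ≈ 0#)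
  ι-2≉0 {p} prime-p 3<p p≈0 2≈0 with p % 2 in eq | m%n<n p 2
  ... | 0 | _ with prime⇒irreducible prime-p (m%n≡0⇒n∣m p 2 eq)
  ...   | inj₂ refl = contradiction 3<p λ { (s≤s (s≤s ())) }
  ι-2≉0 {p} prime-p 3<p p≈0 2≈0 | 1 | _ = F.0≉1 (begin
    0#                                 ≈⟨ p≈0 ⟨
    ι p                                ≡⟨ cong ι (m≡m%n+[m/n]*n p 2) ⟩
    ι (p % 2 ℕ.+ p / 2 ℕ.* 2)          ≡⟨ cong (λ r → ι (r ℕ.+ p / 2 ℕ.* 2)) eq ⟩
    1# F.+ ι (p / 2 ℕ.* 2)             ≈⟨ F.+-congˡ (ι-* (p / 2) 2) ⟩
    1# F.+ ι (p / 2) F.* ι 2           ≈⟨ F.+-congˡ (F.*-congˡ 2≈0) ⟩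
    1# F.+ ι (p / 2) F.* 0#            ≈⟨ F.+-congˡ (F.zeroʳ _) ⟩
    1# F.+ 0#                          ≈⟨ F.+-identityʳ 1# ⟩
    1#                                 ∎)
  ι-2≉0 {p} prime-p 3<p p≈0 2≈0 | suc (suc _) | s≤s (s≤s ())

  η-mod : ∀ {p} a b → ι p ≈ 0# → a ≡ b [mod p ] → η (+ a - + b) ≈ 0#
  η-mod {p} a b p≈0 p∣a-b with Signed.∣ᵤ⇒∣ {+ p} {+ a - + b} p∣a-b
  ... | Signed.divides r eq = begin
    η (+ a - + b)    ≡⟨ cong η eq ⟩
    η (r * + p)      ≈⟨ η-* r (+ p) ⟩
    η r F.* ι p      ≈⟨ F.*-congˡ p≈0 ⟩
    η r F.* 0#       ≈⟨ F.zeroʳ _ ⟩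
    0#               ∎

-- The labelled points over the field and their distances.

module Configuration {c ℓ} (F : Field c ℓ)
  (2≉0 : ¬ Space._≈_ F (Space.ι F 2) (Space.0# F))
  (d : ℕ) (d≈8 : Space._≈_ F (FieldProperties.η F (+ d ℤ.- + 8)) (Space.0# F)) where

  open import Data.Integer.Base using (_+_; _*_; -_; _-_)
  open IntegerCoordinates
  open Space F
  open FieldProperties F

  private
    module F = Field F
    module F-Sum = SemiringSum F.semiring
  open RingProperties F.ring using (+-cancelˡ; -‿distribʳ-*)
  open CommutativeSemigroupProperties F.*-commutativeSemigroup using () renaming (interchange to *-interchange)
  open ≈-Reasoning F.setoid

  4≉0 : ¬ (ι 4 ≈ 0#)
  4≉0 4≈0 = 2≉0 (*-≈0 2≉0 (F.trans (F.sym (ι-* 2 2)) 4≈0))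

  2≉4 : ¬ (ι 2 ≈ ι 4)
  2≉4 2≈4 = 2≉0 (+-cancelˡ (ι 2) _ _ (begin
    ι 2 F.+ ι 2   ≈⟨ ι-+ 2 2 ⟨
    ι 4           ≈⟨ 2≈4 ⟨
    ι 2           ≈⟨ F.+-identityʳ _ ⟨
    ι 2 F.+ 0#    ∎))

  ¼*4≈1 : ¼ F.* ι 4 ≈ 1#
  ¼*4≈1 = F.trans (F.*-comm _ _) (F.inverseʳ (ι 4) 4≉0)

  ½≈2*¼ : ½ ≈ ι 2 F.* ¼
  ½≈2*¼ = begin
    ½                              ≈⟨ F.*-identityʳ _ ⟨
    ½ F.* 1#                       ≈⟨ F.*-congˡ (F.inverseʳ (ι 4) 4≉0) ⟨
    ½ F.* (ι 4 F.* ¼)              ≈⟨ F.*-congˡ (F.*-congʳ (ι-* 2 2)) ⟩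
    ½ F.* (ι 2 F.* ι 2 F.* ¼)      ≈⟨ F.*-congˡ (F.*-assoc _ _ _) ⟩
    ½ F.* (ι 2 F.* (ι 2 F.* ¼))    ≈⟨ F.*-assoc _ _ _ ⟨
    ½ F.* ι 2 F.* (ι 2 F.* ¼)      ≈⟨ F.*-congʳ (F.trans (F.*-comm _ _) (F.inverseʳ (ι 2) 2≉0)) ⟩
    1# F.* (ι 2 F.* ¼)             ≈⟨ F.*-identityˡ _ ⟩
    ι 2 F.* ¼                      ∎

  point : Label d → Fin d → Carrier
  point l k = ¼ F.* η (quadruple l k)

  ¼-difference : ∀ a b → (¼ F.* η a) F.- (¼ F.* η b) ≈ ¼ F.* η (a - b)
  ¼-difference a b = begin
    (¼ F.* η a) F.- (¼ F.* η b)      ≈⟨ F.+-congˡ (-‿distribʳ-* _ _) ⟩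
    ¼ F.* η a F.+ ¼ F.* F.- η b      ≈⟨ F.distribˡ _ _ _ ⟨
    ¼ F.* (η a F.- η b)              ≈⟨ F.*-congˡ (η-- a b) ⟨
    ¼ F.* η (a - b)                  ∎

  -- Clears the scale: 8 · 4 = 16 · 2 and 8 · 8 = 16 · 4 turn the separations 4 and 8 into the
  -- squared distances 2 and 4.
  ¼²*16i≈i : ∀ i → ¼ F.* ¼ F.* η (+ 16 * i) ≈ η i
  ¼²*16i≈i i = begin
    ¼ F.* ¼ F.* η (+ 16 * i)              ≈⟨ F.*-congˡ (η-* (+ 16) i) ⟩
    ¼ F.* ¼ F.* (ι 16 F.* η i)            ≈⟨ F.*-assoc _ _ _ ⟨
    ¼ F.* ¼ F.* ι 16 F.* η i              ≈⟨ F.*-congʳ (F.*-congˡ (ι-* 4 4)) ⟩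
    ¼ F.* ¼ F.* (ι 4 F.* ι 4) F.* η i     ≈⟨ F.*-congʳ (*-interchange _ _ _ _) ⟩
    ¼ F.* ι 4 F.* (¼ F.* ι 4) F.* η i     ≈⟨ F.*-congʳ (F.*-cong ¼*4≈1 ¼*4≈1) ⟩
    1# F.* 1# F.* η i                     ≈⟨ F.*-congʳ (F.*-identityˡ 1#) ⟩
    1# F.* η i                            ≈⟨ F.*-identityˡ _ ⟩
    η i                                   ∎

  -- The factor ¼ leaves each square twice and the remaining sum is taken in ℤ, where `sum-squares`
  -- applies. Its term with factor d - 8 dies by `d≈8`.
  Q-point : ∀ l m → Q (point l ⊖ point m) ≈ ¼ F.* ¼ F.* η (+ 8 * separation l m)
  Q-point l m = begin
    Q (point l ⊖ point m)
      ≈⟨ F-Sum.sum-cong-≋ (λ k → F.*-cong (¼-difference (quadruple l k) (quadruple m k)) (¼-difference (quadruple l k) (quadruple m k))) ⟩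
    F-Sum.sum (λ k → ¼ F.* η (z k) F.* (¼ F.* η (z k)))
      ≈⟨ F-Sum.sum-cong-≋ (λ k → F.trans (*-interchange ¼ (η (z k)) ¼ (η (z k))) (F.*-congˡ (F.sym (η-* (z k) (z k))))) ⟩
    F-Sum.sum (λ k → ¼ F.* ¼ F.* η (z k * z k))
      ≈⟨ F-Sum.*-distribˡ-sum (¼ F.* ¼) (λ k → η (z k * z k)) ⟨
    ¼ F.* ¼ F.* F-Sum.sum (λ k → η (z k * z k))
      ≈⟨ F.*-congˡ (η-sum (λ k → z k * z k)) ⟩
    ¼ F.* ¼ F.* η (ℤ-Sum.sum (λ k → z k * z k))
      ≡⟨ cong (λ s → ¼ F.* ¼ F.* η s) (sum-squares l m) ⟩
    ¼ F.* ¼ F.* η (c² * (+ d - + 8) + + 8 * separation l m)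
      ≈⟨ F.*-congˡ (η-+ (c² * (+ d - + 8)) (+ 8 * separation l m)) ⟩
    ¼ F.* ¼ F.* (η (c² * (+ d - + 8)) F.+ η (+ 8 * separation l m))
      ≈⟨ F.*-congˡ (F.+-congʳ (F.trans (η-* c² (+ d - + 8)) (F.trans (F.*-congˡ d≈8) (F.zeroʳ _)))) ⟩
    ¼ F.* ¼ F.* (0# F.+ η (+ 8 * separation l m))
      ≈⟨ F.*-congˡ (F.+-identityˡ _) ⟩
    ¼ F.* ¼ F.* η (+ 8 * separation l m) ∎
    where
    z : Fin d → ℤ
    z k = quadruple l k - quadruple m k
    c² : ℤ
    c² = (base l - base m) * (base l - base m)

  Q-point≈2 : ∀ l m → separation l m ≡ + 4 → Q (point l ⊖ point m) ≈ ι 2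
  Q-point≈2 l m eq = F.trans (Q-point l m)
    (F.trans (F.reflexive (cong (λ s → ¼ F.* ¼ F.* η (+ 8 * s)) eq)) (¼²*16i≈i (+ 2)))

  Q-point≈4 : ∀ l m → separation l m ≡ + 8 → Q (point l ⊖ point m) ≈ ι 4
  Q-point≈4 l m eq = F.trans (Q-point l m)
    (F.trans (F.reflexive (cong (λ s → ¼ F.* ¼ F.* η (+ 8 * s)) eq)) (¼²*16i≈i (+ 4)))

  Q-cong : ∀ {x x′ y y′ : Fin d → Carrier} → x ≋ x′ → y ≋ y′ → Q (x ⊖ y) ≈ Q (x′ ⊖ y′)
  Q-cong x≋x′ y≋y′ = F-Sum.sum-cong-≋ (λ k → F.*-cong (difference k) (difference k))
    where
    difference = λ k → F.+-cong (x≋x′ k) (F.-‿cong (y≋y′ k))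

  -- Used in contrapositive form: a nonzero value of `Q` separates the two points.
  Q-diagonal : ∀ {x y : Fin d → Carrier} → x ≋ y → Q (x ⊖ y) ≈ 0#
  Q-diagonal {x} {y} x≋y = begin
    Q (x ⊖ y)                     ≈⟨ F-Sum.sum-cong-≋ (λ k → F.trans (F.*-congʳ (vanish k)) (F.zeroˡ _)) ⟩
    F-Sum.sum {d} (λ _ → 0#)      ≈⟨ F-Sum.sum-replicate-zero d ⟩
    0#                            ∎
    where
    vanish = λ k → F.trans (F.+-congʳ (x≋y k)) (F.-‿inverseʳ (y k))

  point-distances : ∀ l m → l ≡ m ⊎ Q (point l ⊖ point m) ≈ ι 2 ⊎ Q (point l ⊖ point m) ≈ ι 4
  point-distances l m = Sum.map₂ (Sum.map (Q-point≈2 l m) (Q-point≈4 l m)) (compare l m)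

  point-injective : ∀ l m → point l ≋ point m → l ≡ m
  point-injective l m l≋m = Sum.[ id , Sum.[ clash 2≉0 , clash 4≉0 ] ] (point-distances l m)
    where
    clash : ∀ {a} → ¬ (a ≈ 0#) → Q (point l ⊖ point m) ≈ a → l ≡ m
    clash a≉0 Q≈a = contradiction (F.trans (F.sym Q≈a) (Q-diagonal l≋m)) a≉0

  -- Identification of the labelled points with the elements of X_d.

  e≈η-δ : ∀ (i k : Fin d) → e i k ≈ η (δ i k)
  e≈η-δ i k with does (i ≟ k)
  ... | true  = F.sym ι-1
  ... | false = F.refl

  -- Undoes the common denominator, since ¼ · 4 = 1, and so reaches the form in which `X` lists its
  -- elements.
  point-split : ∀ l k → point l k ≈ η (base l) F.* ¼ F.* 1# F.+ η (direction l k)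
  point-split l k = begin
    ¼ F.* η (base l + + 4 * u)                     ≈⟨ F.*-congˡ (η-+ (base l) (+ 4 * u)) ⟩
    ¼ F.* (η (base l) F.+ η (+ 4 * u))             ≈⟨ F.distribˡ _ _ _ ⟩
    ¼ F.* η (base l) F.+ ¼ F.* η (+ 4 * u)         ≈⟨ F.+-cong (F.*-comm _ _) (F.*-congˡ (η-* (+ 4) u)) ⟩
    η (base l) F.* ¼ F.+ ¼ F.* (ι 4 F.* η u)       ≈⟨ F.+-cong (F.sym (F.*-identityʳ _)) (F.sym (F.*-assoc _ _ _)) ⟩
    η (base l) F.* ¼ F.* 1# F.+ ¼ F.* ι 4 F.* η u  ≈⟨ F.+-congˡ (F.trans (F.*-congʳ ¼*4≈1) (F.*-identityˡ _)) ⟩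
    η (base l) F.* ¼ F.* 1# F.+ η u                ∎
    where u = direction l k

  expression : Label d → Fin d → Carrier
  expression (pair i j _) = ½ · 𝟏 ⊕ e i ⊕ e j
  expression (low i)      = ¼ · 𝟏 ⊕ e i
  expression (high i)     = ¾ · 𝟏 ⊖ e i
  expression top          = 𝟏

  expression≋point : ∀ l → expression l ≋ point l
  expression≋point l@(pair i j _) k = begin
    ½ F.* 1# F.+ e i k F.+ e j k                  ≈⟨ F.+-assoc _ _ _ ⟩
    ½ F.* 1# F.+ (e i k F.+ e j k)                ≈⟨ F.+-cong (F.*-congʳ ½≈2*¼) (F.+-cong (e≈η-δ i k) (e≈η-δ j k)) ⟩
    ι 2 F.* ¼ F.* 1# F.+ (η (δ i k) F.+ η (δ j k)) ≈⟨ F.+-congˡ (η-+ (δ i k) (δ j k)) ⟨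
    ι 2 F.* ¼ F.* 1# F.+ η (δ i k + δ j k)        ≈⟨ point-split l k ⟨
    point l k                                     ∎
  expression≋point l@(low i) k = begin
    ¼ F.* 1# F.+ e i k                      ≈⟨ F.+-cong (F.*-congʳ (F.trans (F.*-congʳ ι-1) (F.*-identityˡ ¼))) (F.sym (e≈η-δ i k)) ⟨
    ι 1 F.* ¼ F.* 1# F.+ η (δ i k)          ≈⟨ point-split l k ⟨
    point l k                               ∎
  expression≋point l@(high i) k = begin
    ¾ F.* 1# F.- e i k                      ≈⟨ F.+-congˡ (F.-‿cong (e≈η-δ i k)) ⟩
    ¾ F.* 1# F.- η (δ i k)                  ≈⟨ F.+-congˡ (η-neg (δ i k)) ⟨
    ¾ F.* 1# F.+ η (- δ i k)                ≈⟨ point-split l k ⟨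
    point l k                               ∎
  -- `quadruple top k` computes to 4, so the point has all coordinates ¼ · 4.
  expression≋point top k = F.sym (F.trans (F.*-comm _ _) (F.inverseʳ (ι 4) 4≉0))

  ∈X⇒label : ∀ {x} → x ∈ X d → ∃ λ l → x ≋ point l
  ∈X⇒label (inj₁ (i , j , i<j , eq))      = pair i j i<j , λ k → F.trans (eq k) (expression≋point (pair i j i<j) k)
  ∈X⇒label (inj₂ (inj₁ (i , eq)))         = low i  , λ k → F.trans (eq k) (expression≋point (low i) k)
  ∈X⇒label (inj₂ (inj₂ (inj₁ (i , eq))))  = high i , λ k → F.trans (eq k) (expression≋point (high i) k)
  ∈X⇒label (inj₂ (inj₂ (inj₂ eq)))        = top    , λ k → F.trans (eq k) (expression≋point top k)

  point∈X : ∀ l → point l ∈ X d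
  point∈X l@(pair i j i<j) = inj₁ (i , j , i<j , F.sym ∘ expression≋point l)
  point∈X l@(low i)        = inj₂ (inj₁ (i , F.sym ∘ expression≋point l))
  point∈X l@(high i)       = inj₂ (inj₂ (inj₁ (i , F.sym ∘ expression≋point l)))
  point∈X top              = inj₂ (inj₂ (inj₂ (F.sym ∘ expression≋point top)))

  -- The two-distance property and the cardinality.

  isTwoDistanceSet : Fin d → IsTwoDistanceSet (X d) (ι 2) (ι 4)
  isTwoDistanceSet i = 2≉4 , forth , back
    where
    forth : ∀ {r} → SquaredDistances (X d) r → r ≈ ι 2 ⊎ r ≈ ι 4
    forth {r} (x , y , x∈X , y∈X , x≉y , Q≈r) =
      Sum.[ (λ l≡m → contradiction (coincide l≡m) x≉y) , Sum.map (F.trans r≈Q) (F.trans r≈Q) ] (point-distances l m)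
      where
      l m : Label d
      l = proj₁ (∈X⇒label x∈X)
      m = proj₁ (∈X⇒label y∈X)
      x≋l : x ≋ point l
      x≋l = proj₂ (∈X⇒label x∈X)
      y≋m : y ≋ point m
      y≋m = proj₂ (∈X⇒label y∈X)
      r≈Q : r ≈ Q (point l ⊖ point m)
      r≈Q = F.trans (F.sym Q≈r) (Q-cong x≋l y≋m)
      coincide : l ≡ m → x ≋ y
      coincide l≡m k = F.trans (x≋l k) (F.trans (F.reflexive (cong (λ n → point n k) l≡m)) (F.sym (y≋m k)))
    attained : ∀ {r s} l m → ¬ (s ≈ 0#) → Q (point l ⊖ point m) ≈ s → r ≈ s → SquaredDistances (X d) r
    attained l m s≉0 Q≈s r≈s = point l , point m , point∈X l , point∈X m ,
      (λ l≋m → s≉0 (F.trans (F.sym Q≈s) (Q-diagonal l≋m))) , F.trans Q≈s (F.sym r≈s)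
    back : ∀ {r} → r ≈ ι 2 ⊎ r ≈ ι 4 → SquaredDistances (X d) r
    -- Both witnesses use a single index i, so they exist even for d = 1, where there is no pair i <
    -- j.
    back (inj₁ r≈2) = attained (high i) top 2≉0 (Q-point≈2 (high i) top refl) r≈2
    back (inj₂ r≈4) = attained (low i) top 4≉0 (Q-point≈4 (low i) top refl) r≈4

  cardinality : HasCardinality (subsetoid (X d)) ((d ℕ.+ 2) C 2)
  cardinality = record
    { to        = λ n → point (to n) , point∈X (to n)
    ; from      = λ x → from (label x)
    ; to-cong   = λ { refl k → F.refl }
    -- The label is read off a membership proof; injectivity of `point` makes it depend on the
    -- vector alone.
    ; from-cong = λ {x} {y} x≋y → cong from (point-injective (label x) (label y)
        (λ k → F.trans (F.sym (≋label x k)) (F.trans (x≋y k) (≋label y k))))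
    ; inverse   =
        (λ {x} n≡ k → F.trans (F.reflexive (cong (λ l → point l k) (≡.trans (cong to n≡) (strictlyInverseˡ (label x)))))
          (F.sym (≋label x k)))
      , (λ {n} {x} x≋ → ≡.trans (cong from (point-injective (label x) (to n)
          (λ k → F.trans (F.sym (≋label x k)) (x≋ k)))) (strictlyInverseʳ n))
    }
    where
    open Inverse (count-labels d)
    label : ∃ (X d) → Label d
    label x = proj₁ (∈X⇒label (proj₂ x))
    ≋label : ∀ x → proj₁ x ≋ point (label x)
    ≋label x = proj₂ (∈X⇒label (proj₂ x))

-- From the hypotheses on p, q and d to the configuration.

open import Data.Nat.Base using (_+_; _^_; _≤_; _<_)

proposition5p1 : ∀ {c ℓ} (p k q : ℕ) → Prime p → 3 < p → 1 ≤ k → q ≡ p ^ k →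
    (F : Field c ℓ) → HasCardinality (Field.setoid F) q →
    (d : ℕ) → 1 ≤ d → d ≡ 8 [mod p ] →
    let open Space F in
    IsTwoDistanceSet (X d) (ι 2) (ι 4) × HasCardinality (subsetoid (X d)) ((d + 2) C 2)
proposition5p1 p k q prime-p 3<p _ refl F card d 1≤d d≡8 = isTwoDistanceSet (fromℕ< 1≤d) , cardinality
  where
  open FieldProperties F
  p≈0 = ι-^-≈0 (decidable card _ _) k (ι-cardinality card)
  open Configuration F (ι-2≉0 prime-p 3<p p≈0) d (η-mod d 8 p≈0 d≡8)
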